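{- For $n\ge1$ let $T_n$ be the program defined below. The class $\{T_n: n\ge 1\}$ is isomorphically complete with respect to the cascade program product: for every program $P$ there exists a cascade program product $\mathbf P$ all of whose factors are programs from $\{T_n:n\ge1\}$ such that $\Psi_P\in\mathbf I\mathbf S(\{\Psi_{\mathbf P}\})$, i.e. the characteristic automaton of $P$ is isomorphic to a subautomaton of the characteristic automaton of $\mathbf P$.
   Context: Notation: $[n]=\{1,\dots,n\}$. Programs: a (normal logic) program $P$ over a finite nonempty set of atoms $\Gamma_P$ is a finite nonempty set of rules $a\leftarrow b_1,\dots,b_k,\mathrm{not}\,b_{k+1},\dots,\mathrm{not}\,b_m$ ($m\ge k\ge 0$, atoms in $\Gamma_P$); for such a rule $r$, $H(r)=a$, $B^+(r)=\{b_1,\dots,b_k\}$, $B^-(r)=\{b_{k+1},\dots,b_m\}$. $\mathcal I_P$ is the power set of $\Gamma_P$. $\Psi_P:\mathcal I_P\times\mathcal I_P\to\mathcal I_P$ is $\Psi_P(I,J)=\{H(r): r\in P,\ B^+(r)\subseteq I,\ B^-(r)\cap J=\emptyset\}$. The characteristic automaton of $P$ is $\langle \mathcal I_P,\mathcal I_P,\Psi_P\rangle$, also denoted $\Psi_P$. The programs $T_n$: for $n\ge1$ let $\sigma_1,\dots,\sigma_{n^n}$ enumerate all mappings $[n]\to[n]$. $T_n$ is the program over $[n^n]$ consisting of the rules $\sigma_k(j)\leftarrow j,\ \mathrm{not}\,k$ for all $j\in[n]$ and $k\in[n^n]$. Automata: an automaton $\langle Q,\Sigma,\delta\rangle$ has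 finite state set $Q$, finite nonempty input alphabet $\Sigma$, and $\delta:Q\times\Sigma\to Q$. $\langle Q',\Sigma',\delta'\rangle$ is a subautomaton of $\langle Q,\Sigma,\delta\rangle$ if $Q'\subseteq Q$, $\Sigma'\subseteq\Sigma$, $\delta(Q'\times\Sigma')\subseteq Q'$ and $\delta'=\delta|_{Q'\times\Sigma'}$. An isomorphism onto $\langle Q',\Sigma',\delta'\rangle$ is a pair of bijections $h_1:Q\to Q'$, $h_2:\Sigma\to\Sigma'$ with $h_1(\delta(q,x))=\delta'(h_1(q),h_2(x))$ for all $q,x$. $\mathbf S(\mathcal A)$, $\mathbf I(\mathcal A)$ denote the classes of subautomata and isomorphic images of automata in $\mathcal A$. Cascade program product: let $P_1,\dots,P_k$ ($k\ge1$) be programs and $\mathcal I_{\mathbf P}$ a finite nonempty set. A feedforward function is $\psi_{\mathbf P}=(\psi_{\mathbf P,1},\dots,\psi_{\mathbf P,k})$ with $\psi_{\mathbf P,i}:(\mathcal I_{P_1}\times\dots\times\mathcal I_{P_k})\times\mathcal I_{\mathbf P}\to\mathcal I_{P_i}$ not depending on its $j$-th component for any $j\ge i$. The product $\mathbf P=P_1\ltimes\dots\ltimes P_k[\mathcal I_{\mathbf P},\psi_{\mathbf P}]$ has characteristic automaton $\Psi_{\mathbf P}=\langle \mathcal I_{P_1}\times\dots\times\mathcal I_{P_k},\ \mathcal I_{\mathbf P},\ \Psi_{\mathbf P}\rangle$ with $\Psi_{\mathbf P}((I_1,\dots,I_k),\mathbf J)=\big(\Psi_{P_1}(I_1,\psi_{\mathbf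 P,1}(\mathbf J)),\dots,\Psi_{P_k}(I_k,\psi_{\mathbf P,k}((I_1,\dots,I_{k-1}),\mathbf J))\big)$. The product isomorphically represents $P$ if $\Psi_P\in\mathbf I\mathbf S(\{\Psi_{\mathbf P}\})$. -}

module Defs where

open import Level using (0ℓ) renaming (suc to lsuc)
open import Data.Bool.Base using (Bool; true; false; T)
open import Data.Bool.Properties using (T-irrelevant)
open import Data.Fin.Base as Fin using (Fin; zero; suc; inject≤; finToFun; funToFin)
open import Data.Fin.Properties using (+↔⊎; *↔×; 0↔⊥; 1↔⊤; 2↔Bool; funToFin-finToFin; finToFun-funToFin)
open import Data.Fin.Subset using (Subset; ⁅_⁆; ⋃; _∩_; _⊆_; Empty) renaming (⊥ to ∅)
open import Data.Fin.Subset.Properties using (_⊆?_; nonempty?)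
open import Data.List.Base as List using (List; length; filter; allFin; cartesianProductWith)
open import Data.Nat.Base using (ℕ; zero; suc; _+_; _*_; _^_; _≤_; NonZero; >-nonZero⁻¹)
open import Data.Nat.Properties using (m^n≢0; ^-monoʳ-≤; ^-identityʳ; ≤-trans; ≤-reflexive)
open import Data.Product.Base using (Σ-syntax; ∃-syntax; _×_; _,_; proj₁; proj₂)
open import Data.Product.Function.NonDependent.Propositional using (_×-↔_)
open import Data.Sum.Base using (_⊎_; inj₁; inj₂)
open import Data.Sum.Function.Propositional using (_⊎-↔_)
open import Data.Vec.Base as Vec using (Vec; []; _∷_)
open import Data.Vec.Relation.Unary.All using (All; []; _∷_)
open import Data.Vec.Relation.Unary.All.Properties using (lookup⁺; lookup⁻)
open import Function.Base using (_∘_)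
open import Function.Bundles using (_↔_; _⤖_; mk↔ₛ′; Inverse; Bijection)
open import Function.Construct.Composition using (_↔-∘_)
open import Function.Construct.Symmetry using (↔-sym)
open import Function.Definitions using (Bijective)
open import Relation.Binary.PropositionalEquality using (_≡_; _≢_; _≗_; refl; sym; trans; cong; cong₂; subst)
open import Relation.Nullary.Decidable using (Dec; ¬?; _×-dec_)
open import Relation.Unary using (Pred; _∈_; ｛_｝)

Finite : Set → Set
Finite A = ∃[ n ] (A ↔ Fin n)

via : ∀ {A B : Set} → A ↔ B → Finite B → Finite A
via A↔B (n , B↔Fin) = n , (B↔Fin ↔-∘ A↔B)

finite-× : ∀ {A B : Set} → Finite A → Finite B → Finite (A × B)
finite-× (m , f) (n , g) = m * n , (↔-sym *↔× ↔-∘ (f ×-↔ g))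

finite-⊎ : ∀ {A B : Set} → Finite A → Finite B → Finite (A ⊎ B)
finite-⊎ (m , f) (n , g) = m + n , (↔-sym +↔⊎ ↔-∘ (f ⊎-↔ g))

finite-Subset : ∀ n → Finite (Subset n)
finite-Subset zero    = 1 , mk↔ₛ′ (λ _ → zero) (λ _ → []) (λ { zero → refl }) (λ { [] → refl })
finite-Subset (suc n) = via
  (mk↔ₛ′ (λ { (b ∷ p) → b , p }) (λ (b , p) → b ∷ p) (λ { (_ , _) → refl }) (λ { (_ ∷ _) → refl }))
  (finite-× (2 , ↔-sym 2↔Bool) (finite-Subset n))

finite-All : ∀ {A : Set} {B : A → Set} → (∀ x → Finite (B x)) →
             ∀ {n} (xs : Vec A n) → Finite (All B xs)
finite-All fin []       = 1 , mk↔ₛ′ (λ _ → zero) (λ _ → []) (λ { zero → refl }) (λ { [] → refl })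
finite-All fin (x ∷ xs) = via
  (mk↔ₛ′ (λ { (b ∷ bs) → b , bs }) (λ (b , bs) → b ∷ bs) (λ { (_ , _) → refl }) (λ { (_ ∷ _) → refl }))
  (finite-× (fin x) (finite-All fin xs))

-- Subsets of a finite set are decidable, so they are given by Boolean
-- characteristic functions; since T is proof-irrelevant, equality on ⟦ p ⟧ is
-- equality of the underlying elements.
⟦_⟧ : {A : Set} → (A → Bool) → Set
⟦_⟧ {A} p = Σ[ x ∈ A ] T (p x)

⟦⟧-≡ : ∀ {A : Set} (p : A → Bool) {x y : ⟦ p ⟧} → proj₁ x ≡ proj₁ y → x ≡ y
⟦⟧-≡ p {x , _} refl = cong (x ,_) (T-irrelevant _ _)

finite-T : ∀ b → Finite (T b)
finite-T true  = 1 , ↔-sym 1↔⊤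
finite-T false = 0 , ↔-sym 0↔⊥

finite-⟦⟧-Fin : ∀ n (p : Fin n → Bool) → Finite ⟦ p ⟧
finite-⟦⟧-Fin zero    p = 0 , mk↔ₛ′ proj₁ (λ ()) (λ ()) (λ { (() , _) })
finite-⟦⟧-Fin (suc n) p = via
  (mk↔ₛ′ (λ { (zero , t) → inj₁ t ; (suc i , t) → inj₂ (i , t) })
         (λ { (inj₁ t) → zero , t ; (inj₂ (i , t)) → suc i , t })
         (λ { (inj₁ _) → refl ; (inj₂ _) → refl })
         (λ { (zero , _) → refl ; (suc _ , _) → refl }))
  (finite-⊎ (finite-T (p zero)) (finite-⟦⟧-Fin n (p ∘ suc)))

finite-⟦⟧ : ∀ {A : Set} → Finite A → (p : A → Bool) → Finite ⟦ p ⟧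
finite-⟦⟧ (n , A↔Fin) p = via
  (mk↔ₛ′ (λ { (x , t) → to x , subst (T ∘ p) (sym (strictlyInverseʳ x)) t })
         (λ { (i , t) → from i , t })
         (λ { (i , _) → ⟦⟧-≡ (p ∘ from) (strictlyInverseˡ i) })
         (λ { (x , _) → ⟦⟧-≡ p (strictlyInverseʳ x) }))
  (finite-⟦⟧-Fin n (p ∘ from))
  where open Inverse A↔Fin

record Automaton : Set₁ where
  field
    State          : Set
    Letter         : Set
    δ              : State → Letter → State
    state-finite   : Finite State
    letter-finite  : Finite Letter
    letter-witness : Letter

record Subcarrier (A : Automaton) : Set where
  open Automaton A
  field
    Q′          : State → Bool
    Σ′          : Letter → Bool
    Σ′-nonempty : ⟦ Σ′ ⟧
    closed      : ∀ q x → T (Q′ q) → T (Σ′ x) → T (Q′ (δ q x))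

restrict : (A : Automaton) → Subcarrier A → Automaton
restrict A S = record
  { State          = ⟦ Q′ ⟧
  ; Letter         = ⟦ Σ′ ⟧
  ; δ              = λ { (q , q∈Q′) (x , x∈Σ′) → δ q x , closed q x q∈Q′ x∈Σ′ }
  ; state-finite   = finite-⟦⟧ state-finite Q′
  ; letter-finite  = finite-⟦⟧ letter-finite Σ′
  ; letter-witness = Σ′-nonempty
  }
  where
  open Automaton A
  open Subcarrier S

record _≅_ (A B : Automaton) : Set where
  private
    module A = Automaton A
    module B = Automaton B
  field
    h₁   : A.State ⤖ B.State
    h₂   : A.Letter ⤖ B.Letter
    homo : ∀ q x → Bijection.to h₁ (A.δ q x) ≡ B.δ (Bijection.to h₁ q) (Bijection.to h₂ x)

AutomatonClass : Set₂
AutomatonClass = Pred Automaton (lsuc 0ℓ)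

𝐒 : AutomatonClass → AutomatonClass
𝐒 𝒜 B = ∃[ A ] (A ∈ 𝒜 × Σ[ S ∈ Subcarrier A ] B ≡ restrict A S)

𝐈 : AutomatonClass → AutomatonClass
𝐈 𝒜 B = ∃[ A ] (A ∈ 𝒜 × A ≅ B)

record Rule (m : ℕ) : Set where
  constructor rule
  field
    H  : Fin m
    B⁺ : Subset m
    B⁻ : Subset m

-- The set of atoms is Fin ∣Γ∣. The list stands for the set of its entries:
-- order and repetitions do not affect Ψ.
record Program : Set where
  field
    ∣Γ∣            : ℕ
    atoms-nonempty : NonZero ∣Γ∣
    rules          : List (Rule ∣Γ∣)
    rules-nonempty : NonZero (length rules)

open Program using (∣Γ∣; rules)

ℐ : Program → Set
ℐ P = Subset (∣Γ∣ P)

Applicable : ∀ {m} → Subset m → Subset m → Rule m → Set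
Applicable I J r = Rule.B⁺ r ⊆ I × Empty (Rule.B⁻ r ∩ J)

applicable? : ∀ {m} (I J : Subset m) (r : Rule m) → Dec (Applicable I J r)
applicable? I J r = (Rule.B⁺ r ⊆? I) ×-dec ¬? (nonempty? (Rule.B⁻ r ∩ J))

Ψ : (P : Program) → ℐ P → ℐ P → ℐ P
Ψ P I J = ⋃ (List.map (⁅_⁆ ∘ Rule.H) (filter (applicable? I J) (rules P)))

characteristic : Program → Automaton
characteristic P = record
  { State          = ℐ P
  ; Letter         = ℐ P
  ; δ              = Ψ P
  ; state-finite   = finite-Subset (∣Γ∣ P)
  ; letter-finite  = finite-Subset (∣Γ∣ P)
  ; letter-witness = ∅
  }

-- Mappings are compared pointwise.
record Enumeration (n : ℕ) : Set where
  field
    σ         : Fin (n ^ n) → (Fin n → Fin n)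
    bijective : Bijective _≡_ _≗_ σ

standardEnumeration : ∀ n → Enumeration n
standardEnumeration n = record
  { σ         = finToFun
  ; bijective = injective , λ f → funToFin f , λ { refl → finToFun-funToFin f }
  }
  where
  funToFin-cong : ∀ {k l} {f g : Fin k → Fin l} → f ≗ g → funToFin f ≡ funToFin g
  funToFin-cong {zero}  f≗g = refl
  funToFin-cong {suc k} f≗g = cong₂ Fin.combine (f≗g zero) (funToFin-cong (f≗g ∘ suc))

  injective : ∀ {x y : Fin (n ^ n)} → finToFun {n} {n} x ≗ finToFun y → x ≡ y
  injective {x} {y} eq = trans (sym (funToFin-finToFin {n} {n} x))
                        (trans (funToFin-cong eq) (funToFin-finToFin {n} {n} y))

n≤n^n : ∀ n .{{_ : NonZero n}} → n ≤ n ^ n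
n≤n^n n = ≤-trans (≤-reflexive (sym (^-identityʳ n))) (^-monoʳ-≤ n (>-nonZero⁻¹ n))

-- The inclusion [n] ⊆ [n^n].
ι : ∀ n .{{_ : NonZero n}} → Fin n → Fin (n ^ n)
ι n j = inject≤ j (n≤n^n n)

module _ (n : ℕ) .{{_ : NonZero n}} (e : Enumeration n) where
  open Enumeration e

  Trule : Fin n → Fin (n ^ n) → Rule (n ^ n)
  Trule j k = rule (ι n (σ k j)) ⁅ ι n j ⁆ ⁅ k ⁆

  Trules : List (Rule (n ^ n))
  Trules = cartesianProductWith Trule (allFin n) (allFin (n ^ n))

cartesian-nonempty : ∀ {C : Set} n m .{{_ : NonZero n}} .{{_ : NonZero m}} (f : Fin n → Fin m → C) →
                     NonZero (length (cartesianProductWith f (allFin n) (allFin m)))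
cartesian-nonempty (suc _) (suc _) f = _

𝕋 : ∀ n .{{_ : NonZero n}} → Enumeration n → Program
𝕋 n {{n≢0}} e = record
  { ∣Γ∣            = n ^ n
  ; atoms-nonempty = m^n≢0 n n
  ; rules          = Trules n e
  ; rules-nonempty = cartesian-nonempty n (n ^ n) {{n≢0}} {{m^n≢0 n n}} (Trule n e)
  }

-- {T_n : n ≥ 1}, for a fixed choice of the enumerations.
𝒯 : (∀ n .{{_ : NonZero n}} → Enumeration n) → Pred Program 0ℓ
𝒯 enum P = ∃[ n ] Σ[ n≢0 ∈ NonZero n ] P ≡ 𝕋 n {{n≢0}} (enum n {{n≢0}})

record CascadeProduct : Set₁ where
  field
    k             : ℕ
    k≥1           : NonZero k
    factors       : Vec Program k
    Input         : Set
    input-finite  : Finite Input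
    input-witness : Input

  ℐs : Set
  ℐs = All ℐ factors

  -- s and s′ differ at most in their j-th component.
  AgreeOff : Fin k → ℐs → ℐs → Set
  AgreeOff j s s′ = ∀ i → i ≢ j → lookup⁺ s i ≡ lookup⁺ s′ i

  field
    ψ           : (i : Fin k) → ℐs → Input → ℐ (Vec.lookup factors i)
    feedforward : ∀ i j → i Fin.≤ j → ∀ s s′ → AgreeOff j s s′ →
                  ∀ x → ψ i s x ≡ ψ i s′ x

  Ψs : ℐs → Input → ℐs
  Ψs s x = lookup⁻ (λ i → Ψ (Vec.lookup factors i) (lookup⁺ s i) (ψ i s x))

characteristicₚ : CascadeProduct → Automaton
characteristicₚ 𝐏 = record
  { State          = ℐs
  ; Letter         = Input
  ; δ              = Ψs
  ; state-finite   = finite-All (λ P → finite-Subset (∣Γ∣ P)) factors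
  ; letter-finite  = input-finite
  ; letter-witness = input-witness
  }
  where open CascadeProduct 𝐏

_IsomorphicallyRepresents_ : CascadeProduct → Program → Set₁
𝐏 IsomorphicallyRepresents P = characteristic P ∈ 𝐈 (𝐒 ｛ characteristicₚ 𝐏 ｝)

IsomorphicallyComplete : Pred Program 0ℓ → Set₁
IsomorphicallyComplete 𝒦 =
  ∀ (P : Program) → ∃[ 𝐏 ] (All 𝒦 (CascadeProduct.factors 𝐏) × 𝐏 IsomorphicallyRepresents P)

{-# OPTIONS --safe #-}
-- A single factor suffices. Let n be the number of interpretations of P and
-- represent the j-th of them by the singleton {j} ⊆ [n^n]. On the input
-- [n^n] ∖ {k} only the rules σ_k(j) ← j, not k of T_n survive, so T_n maps
-- {j} to {σ_k(j)}. As every self-map of [n] is some σ_k, the feedforward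
-- function can make T_n perform the transition I ↦ Ψ_P(I,J) on each input J.
module Submission where

open import Defs
open import Data.Bool.Base using (Bool; T)
open import Data.Fin.Base using (Fin; zero)
open import Data.Fin.Properties using (any?; inject≤-injective; nonZeroIndex) renaming (_≟_ to _≟ᶠ_)
open import Data.Fin.Subset using (⁅_⁆; ⋃; ∁) renaming (⊥ to ∅; _∈_ to _∈ˢ_)
open import Data.Fin.Subset.Properties using (∉⊥; x∈⁅x⁆; x∈⁅y⁆⇒x≡y; x∈p∪q⁻; x∈p∪q⁺; x∈p∩q⁺; x∈p∩q⁻; x∈p⇒x∉∁p; x∉∁p⇒x∈p; ⊆-antisym)
open import Data.List.Base using ([]; _∷_; allFin)
open import Data.List.Membership.Propositional using () renaming (_∈_ to _∈ˡ_)
open import Data.List.Membership.Propositional.Properties using (∈-map⁺; ∈-map⁻; ∈-filter⁺; ∈-filter⁻; ∈-allFin; ∈-cartesianProductWith⁺; ∈-cartesianProductWith⁻)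
open import Data.List.Relation.Unary.Any using (here; there)
open import Data.Nat.Base using (ℕ; NonZero; _^_)
open import Data.Product.Base using (∃-syntax; _×_; _,_; proj₁; proj₂)
open import Data.Sum.Base using (inj₁; inj₂)
open import Data.Vec.Base using ([]; _∷_)
open import Data.Vec.Relation.Unary.All using (All; []; _∷_)
open import Function.Base using (_∘_)
open import Function.Bundles using (_↔_; mk↔ₛ′; Inverse; Injection)
open import Function.Definitions using (Injective)
open import Function.Properties.Inverse using (↔⇒⤖; ↔⇒↣)
open import Relation.Binary.Definitions using (DecidableEquality)
open import Relation.Binary.PropositionalEquality using (_≡_; refl; sym; trans; cong; cong₂; subst)
open import Relation.Nullary.Decidable using (Dec; ⌊_⌋; map′; toWitness; fromWitness; via-injection)
open import Relation.Unary using (_∈_; ｛_｝)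

finite⇒≟ : ∀ {A : Set} → Finite A → DecidableEquality A
finite⇒≟ (_ , A↔Fin) = via-injection (↔⇒↣ A↔Fin) _≟ᶠ_

module _ {A B : Set} (finA : Finite A) (finB : Finite B) (f : A → B) where

  -- Subcarriers are Boolean predicates, so images have to be decidable; the search runs over the
  -- finitely many codes of `A`.
  preimage? : ∀ y → Dec (∃[ x ] f x ≡ y)
  preimage? y = map′ (λ (i , eq) → from i , eq)
                     (λ (x , eq) → to x , trans (cong f (strictlyInverseʳ x)) eq)
                     (any? (λ i → finite⇒≟ finB (f (from i)) y))
    where open Inverse (proj₂ finA)

  image : B → Bool
  image y = ⌊ preimage? y ⌋

  ∈-image : ∀ x → T (image (f x))
  ∈-image x = fromWitness {a? = preimage? (f x)} (x , refl)

  module _ (f-injective : Injective _≡_ _≡_ f) where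

    preimage : ⟦ image ⟧ → A
    preimage (y , y∈) = proj₁ (toWitness {a? = preimage? y} y∈)

    f-preimage : ∀ y → f (preimage y) ≡ proj₁ y
    f-preimage (y , y∈) = proj₂ (toWitness {a? = preimage? y} y∈)

    image↔ : ⟦ image ⟧ ↔ A
    image↔ = mk↔ₛ′ preimage (λ x → f x , ∈-image x)
      (λ x → f-injective (f-preimage (f x , ∈-image x)))
      (λ y → ⟦⟧-≡ image (f-preimage y))

module _ (A B : Automaton) where
  private
    module A = Automaton A
    module B = Automaton B

  -- The images of `f` and `g` form the subautomaton. Since `𝐈` asks for an isomorphism from it onto
  -- `A`, the bijections are the inverses of `f` and `g` on their images.
  embedding⇒∈𝐈𝐒 : (f : A.State → B.State) (g : A.Letter → B.Letter) →
                  Injective _≡_ _≡_ f → Injective _≡_ _≡_ g →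
                  (∀ q x → f (A.δ q x) ≡ B.δ (f q) (g x)) →
                  A ∈ 𝐈 (𝐒 ｛ B ｝)
  embedding⇒∈𝐈𝐒 f g f-inj g-inj homo =
    restrict B S , (B , refl , S , refl) , record
      { h₁   = ↔⇒⤖ (image↔ A.state-finite B.state-finite f f-inj)
      ; h₂   = ↔⇒⤖ (image↔ A.letter-finite B.letter-finite g g-inj)
      -- After `f` is applied, both sides equal `B.δ q x`.
      ; homo = λ { (q , q∈) (x , x∈) → f-inj (trans (f-pre (_ , closed q x q∈ x∈)) (δ-pre (q , q∈) (x , x∈))) }
      }
    where
    Q′ = image A.state-finite B.state-finite f
    Σ′ = image A.letter-finite B.letter-finite g

    pre₁ = preimage A.state-finite B.state-finite f f-inj
    pre₂ = preimage A.letter-finite B.letter-finite g g-inj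
    f-pre = f-preimage A.state-finite B.state-finite f f-inj
    g-pre = f-preimage A.letter-finite B.letter-finite g g-inj

    -- Serves twice: it puts successors back into the image of `f`, and it carries transitions of
    -- `B` over to `A`.
    δ-pre : ∀ q x → B.δ (proj₁ q) (proj₁ x) ≡ f (A.δ (pre₁ q) (pre₂ x))
    δ-pre q x = trans (sym (cong₂ B.δ (f-pre q) (g-pre x))) (sym (homo (pre₁ q) (pre₂ x)))

    closed : ∀ q x → T (Q′ q) → T (Σ′ x) → T (Q′ (B.δ q x))
    closed q x q∈ x∈ = subst (T ∘ Q′) (sym (δ-pre (q , q∈) (x , x∈)))
                             (∈-image A.state-finite B.state-finite f _)

    S : Subcarrier B
    S = record
      { Q′          = Q′
      ; Σ′          = Σ′
      ; Σ′-nonempty = g A.letter-witness , ∈-image A.letter-finite B.letter-finite g A.letter-witness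
      ; closed      = closed
      }

∈-⋃⁺ : ∀ {n} {x : Fin n} {p ps} → p ∈ˡ ps → x ∈ˢ p → x ∈ˢ ⋃ ps
∈-⋃⁺ (here refl) x∈p = x∈p∪q⁺ (inj₁ x∈p)
∈-⋃⁺ (there p∈)  x∈p = x∈p∪q⁺ (inj₂ (∈-⋃⁺ p∈ x∈p))

∈-⋃⁻ : ∀ {n} {x : Fin n} ps → x ∈ˢ ⋃ ps → ∃[ p ] (p ∈ˡ ps × x ∈ˢ p)
∈-⋃⁻ []       x∈ with () ← ∉⊥ x∈
∈-⋃⁻ (p ∷ ps) x∈ with x∈p∪q⁻ p (⋃ ps) x∈
... | inj₁ x∈p = p , here refl , x∈p
... | inj₂ x∈⋃ with q , q∈ , x∈q ← ∈-⋃⁻ ps x∈⋃ = q , there q∈ , x∈q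

module _ (P : Program) {I J : ℐ P} where
  open Program P using (rules)

  ∈-Ψ⁺ : ∀ {r} → r ∈ˡ rules → Applicable I J r → Rule.H r ∈ˢ Ψ P I J
  ∈-Ψ⁺ r∈ app = ∈-⋃⁺ (∈-map⁺ (⁅_⁆ ∘ Rule.H) (∈-filter⁺ (applicable? I J) r∈ app)) (x∈⁅x⁆ _)

  ∈-Ψ⁻ : ∀ {a} → a ∈ˢ Ψ P I J → ∃[ r ] (r ∈ˡ rules × Applicable I J r × a ≡ Rule.H r)
  ∈-Ψ⁻ a∈ with _ , p∈ , a∈p ← ∈-⋃⁻ _ a∈
          with r , r∈filter , refl ← ∈-map⁻ (⁅_⁆ ∘ Rule.H) p∈
          with r∈ , app ← ∈-filter⁻ (applicable? I J) r∈filter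
    = r , r∈ , app , x∈⁅y⁆⇒x≡y _ a∈p

⁅⁆-injective : ∀ {n} → Injective _≡_ _≡_ (⁅_⁆ {n})
⁅⁆-injective {x = x} {y} eq = x∈⁅y⁆⇒x≡y y (subst (x ∈ˢ_) eq (x∈⁅x⁆ x))

module _ (n : ℕ) .{{_ : NonZero n}} where

  ⁅ι⁆-injective : Injective _≡_ _≡_ (λ j → ⁅ ι n j ⁆)
  ⁅ι⁆-injective = inject≤-injective _ _ _ _ ∘ ⁅⁆-injective

  module _ (e : Enumeration n) where
    open Enumeration e

    -- Only `Trule j k` is applicable: the singleton state fixes the positive body, and the
    -- complement of `⁅ k ⁆` blocks every other negative body.
    Ψ-𝕋 : ∀ j k → Ψ (𝕋 n e) ⁅ ι n j ⁆ (∁ ⁅ k ⁆) ≡ ⁅ ι n (σ k j) ⁆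
    Ψ-𝕋 j k = ⊆-antisym below above
      where
      below : ∀ {a} → a ∈ˢ Ψ (𝕋 n e) ⁅ ι n j ⁆ (∁ ⁅ k ⁆) → a ∈ˢ ⁅ ι n (σ k j) ⁆
      below a∈
        with _ , r∈ , (B⁺⊆ , B⁻∩≡∅) , refl ← ∈-Ψ⁻ (𝕋 n e) a∈
        with j′ , k′ , _ , _ , refl ← ∈-cartesianProductWith⁻ (Trule n e) (allFin n) _ r∈
        with refl ← inject≤-injective (n≤n^n n) (n≤n^n n) j′ j (x∈⁅y⁆⇒x≡y _ (B⁺⊆ (x∈⁅x⁆ _)))
        -- If `k′` lay in the complement of `⁅ k ⁆`, it would meet the negative body and block the
        -- rule.
        with refl ← x∈⁅y⁆⇒x≡y k (x∉∁p⇒x∈p (λ k′∈∁ → B⁻∩≡∅ (k′ , x∈p∩q⁺ (x∈⁅x⁆ k′ , k′∈∁))))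
        = x∈⁅x⁆ _

      above : ∀ {a} → a ∈ˢ ⁅ ι n (σ k j) ⁆ → a ∈ˢ Ψ (𝕋 n e) ⁅ ι n j ⁆ (∁ ⁅ k ⁆)
      above a∈ with refl ← x∈⁅y⁆⇒x≡y _ a∈ =
        ∈-Ψ⁺ (𝕋 n e) (∈-cartesianProductWith⁺ (Trule n e) (∈-allFin j) (∈-allFin k))
          ( (λ b∈ → b∈)
          , λ (_ , b∈) → let b∈⁅k⁆ , b∈∁ = x∈p∩q⁻ _ _ b∈ in x∈p⇒x∉∁p b∈⁅k⁆ b∈∁ )

    index : (Fin n → Fin n) → Fin (n ^ n)
    index f = proj₁ (proj₂ bijective f)

    σ-index : ∀ f j → σ (index f) j ≡ f j
    -- Surjectivity speaks of every argument equal to the chosen preimage; `refl` selects the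
    -- preimage itself.
    σ-index f = proj₂ (proj₂ bijective f) refl

module _ (enum : ∀ (n : ℕ) .{{_ : NonZero n}} → Enumeration n) (P : Program) where
  private
    n = proj₁ (finite-Subset (Program.∣Γ∣ P))
    code = proj₂ (finite-Subset (Program.∣Γ∣ P))
    open Inverse code using (to; from; strictlyInverseʳ)

    instance
      n≢0 : NonZero n
      -- The code of the empty interpretation inhabits `Fin n`.
      n≢0 = nonZeroIndex (to ∅)

    transition : ℐ P → Fin n → Fin n
    transition J j = to (Ψ P (from j) J)

  representative : CascadeProduct
  representative = record
    { k             = 1
    ; k≥1           = _
    ; factors       = 𝕋 n (enum n) ∷ []
    -- Letters are kept as they are, so they stay distinct even when they induce the same
    -- transition.
    ; Input         = ℐ P
    ; input-finite  = finite-Subset (Program.∣Γ∣ P)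
    ; input-witness = ∅
    ; ψ             = λ { zero _ J → ∁ ⁅ index n (enum n) (transition J) ⁆ }
    -- A sole factor may not consult any state; `ψ` reads the letter alone.
    ; feedforward   = λ { zero _ _ _ _ _ _ → refl }
    }

  representative-factors : All (𝒯 enum) (CascadeProduct.factors representative)
  representative-factors = (n , n≢0 , refl) ∷ []

  representative-represents : representative IsomorphicallyRepresents P
  representative-represents =
    embedding⇒∈𝐈𝐒 (characteristic P) (characteristicₚ representative) encode (λ J → J)
      (λ eq → Injection.injective (↔⇒↣ code) (⁅ι⁆-injective n (encode-head eq)))
      (λ eq → eq) (λ I J → cong (_∷ []) (sym (step I J)))
    where
    encode : ℐ P → CascadeProduct.ℐs representative
    encode I = ⁅ ι n (to I) ⁆ ∷ []

    encode-head : ∀ {I I′} → encode I ≡ encode I′ → ⁅ ι n (to I) ⁆ ≡ ⁅ ι n (to I′) ⁆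
    encode-head = cong (λ { (p ∷ []) → p })

    step : ∀ I J → Ψ (𝕋 n (enum n)) ⁅ ι n (to I) ⁆ (∁ ⁅ index n (enum n) (transition J) ⁆)
                   ≡ ⁅ ι n (to (Ψ P I J)) ⁆
    -- `Ψ-𝕋` and `σ-index` leave `transition J` at the code of `I`, and decoding that code returns
    -- `I`.
    step I J = trans (Ψ-𝕋 n (enum n) (to I) _) (cong (λ j → ⁅ ι n j ⁆)
      (trans (σ-index n (enum n) (transition J) (to I)) (cong (λ I′ → to (Ψ P I′ J)) (strictlyInverseʳ I))))

theorem5p1 : (enum : ∀ (n : ℕ) .{{_ : NonZero n}} → Enumeration n) → IsomorphicallyComplete (𝒯 enum)
theorem5p1 enum P = representative enum P , representative-factors enum P , representative-represents enum P
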